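{- Let $N$ be a positive integer. The set \[ S' = \left\{ \begin{bmatrix} 0 & 1 \\ -1 & \alpha \end{bmatrix} : \alpha \in \mathbb{Z}/N\mathbb{Z} \right\} \] generates $\mathrm{SL}_2(\mathbb{Z}/N\mathbb{Z})$ as a semigroup.
   Context: $\mathrm{SL}_2(\mathbb{Z}/N\mathbb{Z})$ is the group of $2\times 2$ matrices over $\mathbb{Z}/N\mathbb{Z}$ of determinant one. Generating as a semigroup means that every element is a finite nonempty product of elements of $S'$ (no inverses). -}

module Defs where

open import Level using (Level; _⊔_; 0ℓ)
open import Algebra.Bundles using (CommutativeRing; Group; Semigroup)
import Algebra.Properties.Ring as RingProperties
import Algebra.Solver.Ring.NaturalCoefficients.Default as SemiringSolver
open import Data.Integer.Base as ℤ using (ℤ; +_)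
import Data.Integer.Properties as ℤ
open import Data.Integer.Divisibility.Signed as ℤ using (_∣_)
open import Data.Integer.Tactic.RingSolver using (solve-∀)
open import Data.List.NonEmpty.Base using (List⁺; toList; foldr₁)
open import Data.List.Relation.Unary.All using (All)
open import Data.Nat.Base using (ℕ)
open import Data.Product.Base using (∃; _×_; _,_)
open import Relation.Binary.PropositionalEquality.Core as ≡ using (_≡_)
import Relation.Binary.Reasoning.Setoid as SetoidReasoning
open import Relation.Unary using (Pred)

private
  variable
    c ℓ p : Level

-- The ring ℤ/Nℤ as a setoid: its elements are represented by integers, and
-- its equality is congruence modulo N.
module _ (N : ℕ) where

  infix 4 _≈ₙ_

  -- A record, so that x and y can be inferred from a proof of x ≈ₙ y.
  record _≈ₙ_ (x y : ℤ) : Set where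
    constructor congruent
    field
      N∣x-y : + N ∣ x ℤ.- y

  private
    reflexive : ∀ {x y} → x ≡ y → x ≈ₙ y
    reflexive {x} ≡.refl = congruent (ℤ.divides (+ 0) (ℤ.+-inverseʳ x))

    via : ∀ {x y z} → x ℤ.- y ≡ z → + N ∣ z → x ≈ₙ y
    via eq N∣z = congruent (≡.subst (+ N ∣_) (≡.sym eq) N∣z)

    sym-eq : ∀ x y → y ℤ.- x ≡ ℤ.- (x ℤ.- y)
    sym-eq = solve-∀

    trans-eq : ∀ x y z → x ℤ.- z ≡ (x ℤ.- y) ℤ.+ (y ℤ.- z)
    trans-eq = solve-∀

    +-eq : ∀ x y u v → (x ℤ.+ u) ℤ.- (y ℤ.+ v) ≡ (x ℤ.- y) ℤ.+ (u ℤ.- v)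
    +-eq = solve-∀

    *-eq : ∀ x y u v →
           x ℤ.* u ℤ.- y ℤ.* v ≡ (x ℤ.- y) ℤ.* u ℤ.+ y ℤ.* (u ℤ.- v)
    *-eq = solve-∀

    neg-eq : ∀ x y → (ℤ.- x) ℤ.- (ℤ.- y) ≡ ℤ.- (x ℤ.- y)
    neg-eq = solve-∀

  ℤ/_ : CommutativeRing 0ℓ 0ℓ
  ℤ/_ = record
    { Carrier = ℤ
    ; _≈_     = _≈ₙ_
    ; _+_     = ℤ._+_
    ; _*_     = ℤ._*_
    ; -_      = ℤ.-_
    ; 0#      = + 0
    ; 1#      = + 1
    ; isCommutativeRing = record
      { isRing = record
        { +-isAbelianGroup = record
          { isGroup = record
            { isMonoid = record
              { isSemigroup = record
                { isMagma = record
                  { isEquivalence = record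
                    { refl  = reflexive ≡.refl
                    ; sym   = λ {x} {y} (congruent p) → via (sym-eq x y) (ℤ.∣m⇒∣-m p)
                    ; trans = λ {x} {y} {z} (congruent p) (congruent q) →
                        via (trans-eq x y z) (ℤ.∣m∣n⇒∣m+n p q)
                    }
                  ; ∙-cong = λ {x} {y} {u} {v} (congruent p) (congruent q) →
                      via (+-eq x y u v) (ℤ.∣m∣n⇒∣m+n p q)
                  }
                ; assoc = λ x y z → reflexive (ℤ.+-assoc x y z)
                }
              ; identity = (λ x → reflexive (ℤ.+-identityˡ x))
                         , (λ x → reflexive (ℤ.+-identityʳ x))
              }
            ; inverse = (λ x → reflexive (ℤ.+-inverseˡ x))
                      , (λ x → reflexive (ℤ.+-inverseʳ x))
            ; ⁻¹-cong = λ {x} {y} (congruent p) → via (neg-eq x y) (ℤ.∣m⇒∣-m p)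
            }
          ; comm = λ x y → reflexive (ℤ.+-comm x y)
          }
        ; *-cong = λ {x} {y} {u} {v} (congruent p) (congruent q) →
            via (*-eq x y u v)
                (ℤ.∣m∣n⇒∣m+n (ℤ.∣m⇒∣m*n u p) (ℤ.∣n⇒∣m*n y q))
        ; *-assoc = λ x y z → reflexive (ℤ.*-assoc x y z)
        ; *-identity = (λ x → reflexive (ℤ.*-identityˡ x))
                     , (λ x → reflexive (ℤ.*-identityʳ x))
        ; distrib = (λ x y z → reflexive (ℤ.*-distribˡ-+ x y z))
                  , (λ x y z → reflexive (ℤ.*-distribʳ-+ x y z))
        }
      ; *-comm = λ x y → reflexive (ℤ.*-comm x y)
      }
    }

module _ (R : CommutativeRing c ℓ) where

  open CommutativeRing R
  open RingProperties ring
  open SemiringSolver commutativeSemiring using (solve; _:=_; _:+_; _:*_)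

  -- mat₂ a b c d is the matrix with rows (a , b) and (c , d).
  record Matrix₂ : Set c where
    constructor mat₂
    field
      e₁₁ e₁₂ e₂₁ e₂₂ : Carrier

  open Matrix₂

  infix 4 _≋_

  record _≋_ (A B : Matrix₂) : Set ℓ where
    constructor eq₂
    field
      eq₁₁ : e₁₁ A ≈ e₁₁ B
      eq₁₂ : e₁₂ A ≈ e₁₂ B
      eq₂₁ : e₂₁ A ≈ e₂₁ B
      eq₂₂ : e₂₂ A ≈ e₂₂ B

  infixl 7 _·_

  _·_ : Matrix₂ → Matrix₂ → Matrix₂
  mat₂ a b c d · mat₂ a′ b′ c′ d′ =
    mat₂ (a * a′ + b * c′) (a * b′ + b * d′)
         (c * a′ + d * c′) (c * b′ + d * d′)

  I₂ : Matrix₂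
  I₂ = mat₂ 1# 0# 0# 1#

  adjugate : Matrix₂ → Matrix₂
  adjugate (mat₂ a b c d) = mat₂ d (- b) (- c) a

  det : Matrix₂ → Carrier
  det (mat₂ a b c d) = a * d - b * c

  record SpecialMatrix₂ : Set (c ⊔ ℓ) where
    constructor special
    field
      matrix : Matrix₂
      det≈1  : det matrix ≈ 1#

  open SpecialMatrix₂

  private
    cancelʳ : ∀ x y z → (x + z) - (y + z) ≈ x - y
    cancelʳ x y z = begin
      (x + z) - (y + z)          ≈⟨ +-congˡ (-‿+-comm y z) ⟨
      (x + z) + (- y + - z)      ≈⟨ solve 4 (λ x y z w → (x :+ z) :+ (y :+ w)
                                     := (x :+ y) :+ (z :+ w)) refl x (- y) z (- z) ⟩
      (x - y) + (z - z)          ≈⟨ +-congˡ (-‿inverseʳ z) ⟩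
      (x - y) + 0#               ≈⟨ +-identityʳ _ ⟩
      x - y                      ∎
      where open SetoidReasoning setoid

    product-of-differences : ∀ u v s t →
      (u - v) * (s - t) ≈ (u * s + v * t) - (u * t + v * s)
    product-of-differences u v s t = begin
      (u - v) * (s - t)
        ≈⟨ solve 4 (λ u v s t → (u :+ v) :* (s :+ t)
             := (u :* s :+ v :* t) :+ (u :* t :+ v :* s)) refl u (- v) s (- t) ⟩
      (u * s + - v * - t) + (u * - t + - v * s)
        ≈⟨ +-cong (+-congˡ -v*-t≈v*t)
             (+-cong (sym (-‿distribʳ-* u t)) (sym (-‿distribˡ-* v s))) ⟩
      (u * s + v * t) + (- (u * t) + - (v * s))
        ≈⟨ +-congˡ (-‿+-comm (u * t) (v * s)) ⟩
      (u * s + v * t) - (u * t + v * s) ∎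
      where
      open SetoidReasoning setoid
      -v*-t≈v*t : - v * - t ≈ v * t
      -v*-t≈v*t = trans (sym (-‿distribˡ-* v (- t)))
        (trans (-‿cong (sym (-‿distribʳ-* v t))) (-‿involutive (v * t)))

    det-· : ∀ A B → det (A · B) ≈ det A * det B
    det-· (mat₂ a b c d) (mat₂ a′ b′ c′ d′) = begin
      (a * a′ + b * c′) * (c * b′ + d * d′) - (a * b′ + b * d′) * (c * a′ + d * c′)
        ≈⟨ +-cong
             (solve 8 (λ a b c d a′ b′ c′ d′ →
                (a :* a′ :+ b :* c′) :* (c :* b′ :+ d :* d′)
                := ((a :* d) :* (a′ :* d′) :+ (b :* c) :* (b′ :* c′))
                   :+ (a :* a′ :* c :* b′ :+ b :* c′ :* d :* d′))
                refl a b c d a′ b′ c′ d′)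
             (-‿cong (solve 8 (λ a b c d a′ b′ c′ d′ →
                (a :* b′ :+ b :* d′) :* (c :* a′ :+ d :* c′)
                := ((a :* d) :* (b′ :* c′) :+ (b :* c) :* (a′ :* d′))
                   :+ (a :* a′ :* c :* b′ :+ b :* c′ :* d :* d′))
                refl a b c d a′ b′ c′ d′)) ⟩
      ((a * d) * (a′ * d′) + (b * c) * (b′ * c′) + z)
        - ((a * d) * (b′ * c′) + (b * c) * (a′ * d′) + z)
        ≈⟨ cancelʳ _ _ z ⟩
      ((a * d) * (a′ * d′) + (b * c) * (b′ * c′))
        - ((a * d) * (b′ * c′) + (b * c) * (a′ * d′))
        ≈⟨ product-of-differences (a * d) (b * c) (a′ * d′) (b′ * c′) ⟨
      (a * d - b * c) * (a′ * d′ - b′ * c′) ∎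
      where
      open SetoidReasoning setoid
      z = a * a′ * c * b′ + b * c′ * d * d′

    det-I₂ : det I₂ ≈ 1#
    det-I₂ = begin
      1# * 1# - 0# * 0#  ≈⟨ +-cong (*-identityˡ 1#) (-‿cong (zeroˡ 0#)) ⟩
      1# - 0#            ≈⟨ +-congˡ -0#≈0# ⟩
      1# + 0#            ≈⟨ +-identityʳ 1# ⟩
      1#                 ∎
      where open SetoidReasoning setoid

    x*-y≈-x*y : ∀ x y → x * - y ≈ - (x * y)
    x*-y≈-x*y x y = sym (-‿distribʳ-* x y)

    -x*y≈-x*y : ∀ x y → - x * y ≈ - (x * y)
    -x*y≈-x*y x y = sym (-‿distribˡ-* x y)

    det-adjugate : ∀ A → det (adjugate A) ≈ det A
    det-adjugate (mat₂ a b c d) = +-cong (*-comm d a) (-‿cong (begin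
      - b * - c      ≈⟨ -x*y≈-x*y b (- c) ⟩
      - (b * - c)    ≈⟨ -‿cong (x*-y≈-x*y b c) ⟩
      - - (b * c)    ≈⟨ -‿involutive (b * c) ⟩
      b * c          ∎))
      where open SetoidReasoning setoid

    ·-cong : ∀ {A A′ B B′} → A ≋ A′ → B ≋ B′ → (A · B) ≋ (A′ · B′)
    ·-cong (eq₂ p q r s) (eq₂ p′ q′ r′ s′) = eq₂
      (+-cong (*-cong p p′) (*-cong q r′)) (+-cong (*-cong p q′) (*-cong q s′))
      (+-cong (*-cong r p′) (*-cong s r′)) (+-cong (*-cong r q′) (*-cong s s′))

    ·-assoc : ∀ A B C → ((A · B) · C) ≋ (A · (B · C))
    ·-assoc (mat₂ a b c d) (mat₂ a′ b′ c′ d′) (mat₂ a″ b″ c″ d″) =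
      eq₂ (entry a b a″ c″) (entry a b b″ d″) (entry c d a″ c″) (entry c d b″ d″)
      where
      entry : ∀ x y u v → (x * a′ + y * c′) * u + (x * b′ + y * d′) * v
                        ≈ x * (a′ * u + b′ * v) + y * (c′ * u + d′ * v)
      entry x y u v = solve 8 (λ x y u v a b c d →
        (x :* a :+ y :* c) :* u :+ (x :* b :+ y :* d) :* v
        := x :* (a :* u :+ b :* v) :+ y :* (c :* u :+ d :* v))
        refl x y u v a′ b′ c′ d′

    ·-identityˡ : ∀ A → (I₂ · A) ≋ A
    ·-identityˡ (mat₂ a b c d) = eq₂ (top a c) (top b d) (bottom a c) (bottom b d)
      where
      top : ∀ x y → 1# * x + 0# * y ≈ x
      top x y = trans (+-cong (*-identityˡ x) (zeroˡ y)) (+-identityʳ x)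
      bottom : ∀ x y → 0# * x + 1# * y ≈ y
      bottom x y = trans (+-cong (zeroˡ x) (*-identityˡ y)) (+-identityˡ y)

    ·-identityʳ : ∀ A → (A · I₂) ≋ A
    ·-identityʳ (mat₂ a b c d) = eq₂ (left a b) (right a b) (left c d) (right c d)
      where
      left : ∀ x y → x * 1# + y * 0# ≈ x
      left x y = trans (+-cong (*-identityʳ x) (zeroʳ y)) (+-identityʳ x)
      right : ∀ x y → x * 0# + y * 1# ≈ y
      right x y = trans (+-cong (zeroʳ x) (*-identityʳ y)) (+-identityˡ y)

    ·-inverseʳ : ∀ A → det A ≈ 1# → (A · adjugate A) ≋ I₂
    ·-inverseʳ (mat₂ a b c d) det≈1 = eq₂
      (trans (+-congˡ (x*-y≈-x*y b c)) det≈1)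
      (trans (+-cong (x*-y≈-x*y a b) (*-comm b a)) (-‿inverseˡ (a * b)))
      (trans (+-cong (*-comm c d) (x*-y≈-x*y d c)) (-‿inverseʳ (d * c)))
      (trans (+-cong (trans (x*-y≈-x*y c b) (-‿cong (*-comm c b))) (*-comm d a))
             (trans (+-comm _ _) det≈1))

    ·-inverseˡ : ∀ A → det A ≈ 1# → (adjugate A · A) ≋ I₂
    ·-inverseˡ (mat₂ a b c d) det≈1 = eq₂
      (trans (+-cong (*-comm d a) (-x*y≈-x*y b c)) det≈1)
      (trans (+-cong (*-comm d b) (-x*y≈-x*y b d)) (-‿inverseʳ (b * d)))
      (trans (+-cong (-x*y≈-x*y c a) (*-comm a c)) (-‿inverseˡ (c * a)))
      (trans (+-cong (trans (-x*y≈-x*y c b) (-‿cong (*-comm c b))) refl)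
             (trans (+-comm _ _) det≈1))

  SL₂ : Group (c ⊔ ℓ) ℓ
  SL₂ = record
    { Carrier = SpecialMatrix₂
    ; _≈_     = λ A B → matrix A ≋ matrix B
    ; _∙_     = λ A B → special (matrix A · matrix B)
        (trans (det-· (matrix A) (matrix B))
               (trans (*-cong (det≈1 A) (det≈1 B)) (*-identityˡ 1#)))
    ; ε       = special I₂ det-I₂
    ; _⁻¹     = λ A → special (adjugate (matrix A))
        (trans (det-adjugate (matrix A)) (det≈1 A))
    ; isGroup = record
      { isMonoid = record
        { isSemigroup = record
          { isMagma = record
            { isEquivalence = record
              { refl  = eq₂ refl refl refl refl
              ; sym   = λ (eq₂ p q r s) → eq₂ (sym p) (sym q) (sym r) (sym s)
              ; trans = λ (eq₂ p q r s) (eq₂ p′ q′ r′ s′) →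
                  eq₂ (trans p p′) (trans q q′) (trans r r′) (trans s s′)
              }
            ; ∙-cong = ·-cong
            }
          ; assoc = λ A B C → ·-assoc (matrix A) (matrix B) (matrix C)
          }
        ; identity = (λ A → ·-identityˡ (matrix A))
                   , (λ A → ·-identityʳ (matrix A))
        }
      ; inverse = (λ A → ·-inverseˡ (matrix A) (det≈1 A))
                , (λ A → ·-inverseʳ (matrix A) (det≈1 A))
      ; ⁻¹-cong = λ (eq₂ p q r s) → eq₂ s (-‿cong q) (-‿cong r) p
      }
    }

  S′-element : Carrier → SpecialMatrix₂
  S′-element α = special (mat₂ 0# 1# (- 1#) α) (begin
    0# * α - 1# * - 1#  ≈⟨ +-cong (zeroˡ α) (-‿cong (*-identityˡ (- 1#))) ⟩
    0# - - 1#           ≈⟨ +-identityˡ _ ⟩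
    - - 1#              ≈⟨ -‿involutive 1# ⟩
    1#                  ∎)
    where open SetoidReasoning setoid

  S′ : Pred SpecialMatrix₂ (c ⊔ ℓ)
  S′ A = ∃ λ α → Group._≈_ SL₂ A (S′-element α)

module _ (G : Semigroup c ℓ) where

  open Semigroup G

  GeneratesAsSemigroup : Pred Carrier p → Set (c ⊔ ℓ ⊔ p)
  GeneratesAsSemigroup S =
    ∀ g → ∃ λ (xs : List⁺ Carrier) → All S (toList xs) × foldr₁ _∙_ xs ≈ g

{-# OPTIONS --safe #-}

-- Over ℤ, left division by the generator with parameter q sends the first
-- column (a , c) to (q a − c , a).  With q the quotient of c by a this is a step
-- of Euclid's algorithm, so a matrix is reduced to an upper triangular one
-- [g b ; 0 d].  Here g need not be 1, only a unit modulo N, and since g d ≡ 1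
-- this matrix is the product of the generators with parameters −d, −g and
-- −(1 + b) d.

module Submission where

open import Defs
open import Algebra.Bundles using (CommutativeRing; Group; Semigroup)
open import Data.Integer.Base
  using (ℤ; +_; +0; +[1+_]; -[1+_]; ∣_∣; 0ℤ; 1ℤ; _+_; _*_; -_; _-_)
import Data.Integer.Base as ℤ
open import Data.Integer.Properties using (∣-i∣≡∣i∣)
open import Data.Integer.DivMod using (_/_; _%_; a≡a%n+[a/n]*n; n%d<d)
open import Data.Integer.Divisibility.Signed using (_∣_; ∣n⇒∣m*n)
open import Data.Integer.Tactic.RingSolver using (solve-∀)
open import Data.List.NonEmpty.Base using (List⁺; toList; foldr₁; _∷⁺_; [_])
open import Data.List.Relation.Unary.All using (All; _∷_; [])
open import Data.Nat.Base using (ℕ; NonZero; _<_)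
open import Data.Nat.Induction using (Acc; acc; <-wellFounded)
open import Data.Product.Base using (∃; _×_; _,_)
open import Level using (Level; _⊔_)
open import Relation.Binary.PropositionalEquality
  using (_≡_; sym; cong; subst; module ≡-Reasoning)
open import Relation.Unary using (Pred; _∈_)

private
  variable
    c ℓ p : Level

module _ (G : Semigroup c ℓ) where

  open module G = Semigroup G using (Carrier; _∙_; _≈_; ∙-congˡ)

  -- A data type, so that g can be inferred from a proof of g ∈ Generated S.
  data Generated (S : Pred Carrier p) : Pred Carrier (c ⊔ ℓ ⊔ p) where
    generator : ∀ s → s ∈ S → Generated S s
    -- Taking `h` only up to `≈` lets matrix entries be compared modulo N at each step.
    prepend   : ∀ s {g h} → s ∈ S → Generated S g → s ∙ g ≈ h → Generated S h

  generated⇒generates : ∀ {S : Pred Carrier p} →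
    (∀ g → g ∈ Generated S) → GeneratesAsSemigroup G S
  generated⇒generates {S = S} all-generated g = product (all-generated g)
    where
    product : ∀ {h} → h ∈ Generated S →
      ∃ λ (xs : List⁺ Carrier) → All S (toList xs) × foldr₁ _∙_ xs ≈ h
    product (generator s s∈S) = [ s ] , s∈S ∷ [] , G.refl
    product (prepend s s∈S g∈ sg≈h) with product g∈
    ... | xs , xs⊆S , xs≈g =
      s ∷⁺ xs , s∈S ∷ xs⊆S , G.trans (∙-congˡ xs≈g) sg≈h

-- The difference is the negated remainder of `i` modulo `j`.
∣[i/j]*j-i∣<∣j∣ : ∀ i j .{{_ : ℤ.NonZero j}} → ∣ i / j * j - i ∣ < ∣ j ∣
∣[i/j]*j-i∣<∣j∣ i j = subst (_< ∣ j ∣) (sym eq) (n%d<d i j)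
  where
  open ≡-Reasoning
  cancel : ∀ r m → m - (r + m) ≡ - r
  cancel = solve-∀
  eq : ∣ i / j * j - i ∣ ≡ i % j
  eq = begin
    ∣ i / j * j - i ∣
      ≡⟨ cong (λ k → ∣ i / j * j - k ∣) (a≡a%n+[a/n]*n i j) ⟩
    ∣ i / j * j - (+ (i % j) + i / j * j) ∣
      ≡⟨ cong ∣_∣ (cancel (+ (i % j)) (i / j * j)) ⟩
    ∣ - + (i % j) ∣
      ≡⟨ ∣-i∣≡∣i∣ (+ (i % j)) ⟩
    i % j ∎

module _ (N : ℕ) where

  private
    module R = CommutativeRing (ℤ/ N)
    module SL = Group (SL₂ (ℤ/ N))

  GeneratedByS′ : SpecialMatrix₂ (ℤ/ N) → Set
  GeneratedByS′ = Generated SL.semigroup (S′ (ℤ/ N))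

  S′-element∈S′ : ∀ α → S′-element (ℤ/ N) α ∈ S′ (ℤ/ N)
  S′-element∈S′ α = α , SL.refl {S′-element (ℤ/ N) α}

  prepend-S′ : ∀ α {g h} → GeneratedByS′ g →
    S′-element (ℤ/ N) α SL.∙ g SL.≈ h → GeneratedByS′ h
  prepend-S′ α = prepend (S′-element (ℤ/ N) α) (S′-element∈S′ α)

  -- With the cofactor `k` given explicitly, a consequence of det ≈ 1 becomes an integer polynomial
  -- identity, within reach of the ring solver.
  ≈1⇒≈ : ∀ {u x y} k → u R.≈ 1ℤ → x - y ≡ k * (u - 1ℤ) → x R.≈ y
  ≈1⇒≈ k (congruent N∣u-1) eq =
    congruent (subst (+ N ∣_) (sym eq) (∣n⇒∣m*n k N∣u-1))

  upper-triangular-generated : ∀ g b d det≈1 →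
    GeneratedByS′ (special (mat₂ g b 0ℤ d) det≈1)
  upper-triangular-generated g b d det≈1 =
    -- For parameters x, y, z the product has first row (-y, yz - 1) and lower left entry 1 - xy.
    -- Matching these with g, b and 0 forces y = -g, x = -d and z = -(1 + b) d, as d inverts g
    -- modulo N.
    prepend-S′ (- d)
      (prepend-S′ (- g) {h = S′-element (ℤ/ N) (- g) SL.∙ last}
        (generator last (S′-element∈S′ (- ((1ℤ + b) * d))))
        (SL.refl {S′-element (ℤ/ N) (- g) SL.∙ last}))
      (eq₂ (≈1⇒≈ 0ℤ det≈1 (entry₁₁ g b d))
           (≈1⇒≈ (1ℤ + b) det≈1 (entry₁₂ g b d))
           (≈1⇒≈ (- 1ℤ) det≈1 (entry₂₁ g b d))
           (≈1⇒≈ (- ((1ℤ + b) * d)) det≈1 (entry₂₂ g b d)))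
    where
    last = S′-element (ℤ/ N) (- ((1ℤ + b) * d))
    entry₁₁ : ∀ g b d →
      0ℤ * (0ℤ * 0ℤ + 1ℤ * - 1ℤ) + 1ℤ * (- 1ℤ * 0ℤ + - g * - 1ℤ) - g
      ≡ 0ℤ * (g * d - b * 0ℤ - 1ℤ)
    entry₁₁ = solve-∀
    entry₁₂ : ∀ g b d →
      0ℤ * (0ℤ * 1ℤ + 1ℤ * - ((1ℤ + b) * d))
        + 1ℤ * (- 1ℤ * 1ℤ + - g * - ((1ℤ + b) * d)) - b
      ≡ (1ℤ + b) * (g * d - b * 0ℤ - 1ℤ)
    entry₁₂ = solve-∀
    entry₂₁ : ∀ g b d →
      - 1ℤ * (0ℤ * 0ℤ + 1ℤ * - 1ℤ) + - d * (- 1ℤ * 0ℤ + - g * - 1ℤ) - 0ℤ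
      ≡ - 1ℤ * (g * d - b * 0ℤ - 1ℤ)
    entry₂₁ = solve-∀
    entry₂₂ : ∀ g b d →
      - 1ℤ * (0ℤ * 1ℤ + 1ℤ * - ((1ℤ + b) * d))
        + - d * (- 1ℤ * 1ℤ + - g * - ((1ℤ + b) * d)) - d
      ≡ - ((1ℤ + b) * d) * (g * d - b * 0ℤ - 1ℤ)
    entry₂₂ = solve-∀

  -- The matrix in the hypothesis is the inverse of `S′-element q` times the target. Both have the
  -- same determinant already over ℤ, so the proof of `det≈1` carries over.
  divide-generated : ∀ q a b c d →
    (∀ det≈1 → GeneratedByS′ (special (mat₂ (q * a - c) (q * b - d) a b) det≈1)) →
    ∀ det≈1 → GeneratedByS′ (special (mat₂ a b c d) det≈1)
  divide-generated q a b c d quotient-generated det≈1 =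
    prepend-S′ q
      (quotient-generated (R.trans (R.reflexive (det-eq q a b c d)) det≈1))
      (eq₂ (R.reflexive (top q a c)) (R.reflexive (top q b d))
           (R.reflexive (bottom q a c)) (R.reflexive (bottom q b d)))
    where
    det-eq : ∀ q a b c d → (q * a - c) * b - (q * b - d) * a ≡ a * d - b * c
    det-eq = solve-∀
    top : ∀ q x y → 0ℤ * (q * x - y) + 1ℤ * x ≡ x
    top = solve-∀
    bottom : ∀ q x y → - 1ℤ * (q * x - y) + q * x ≡ y
    bottom = solve-∀

  -- The upper left entry is the divisor in Euclid's algorithm, so its absolute value decreases
  -- until it reaches 0.
  all-generated : ∀ a b c d → Acc _<_ ∣ a ∣ →
    ∀ det≈1 → GeneratedByS′ (special (mat₂ a b c d) det≈1)
  euclid-step : ∀ a .{{_ : ℤ.NonZero a}} b c d → Acc _<_ ∣ a ∣ →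
    ∀ det≈1 → GeneratedByS′ (special (mat₂ a b c d) det≈1)

  all-generated +0 b c d _ =
    -- Dividing with quotient 0 moves the vanishing entry `a` to the lower left corner.
    divide-generated 0ℤ 0ℤ b c d (upper-triangular-generated _ _ b)
  -- Matching on the sign makes `NonZero a` resolvable by instance search.
  all-generated a@(+[1+ _ ]) = euclid-step a
  all-generated a@(-[1+ _ ]) = euclid-step a

  euclid-step a b c d (acc rs) =
    divide-generated (c / a) a b c d
      (all-generated _ _ a b (rs (∣[i/j]*j-i∣<∣j∣ c a)))

lemma4p1 : (N : ℕ) → .{{_ : NonZero N}} → GeneratesAsSemigroup (Group.semigroup (SL₂ (ℤ/ N))) (S′ (ℤ/ N))
lemma4p1 N = generated⇒generates (Group.semigroup (SL₂ (ℤ/ N)))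
  λ (special (mat₂ a b c d) det≈1) →
    all-generated N a b c d (<-wellFounded ∣ a ∣) det≈1
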